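{- Let $\to^*$ denote the reflexive-transitive closure of reduction in $\lambda^{\textsc{prk}}_\eta$. With the derived terms $\langle\cdot,\cdot\rangle^{\mathcal C}$, $\pi_i^{\mathcal C}$, $\mathsf{in}_i^{\mathcal C}$, $\delta^{\mathcal C}$, $\lambda^{\mathcal C}$, $@^{\mathcal C}$, $\pitchfork^{\mathcal C}_A$ defined in the context, for all terms typed as required by their definitions and $i\in\{1,2\}$: 1. If $\Gamma\vdash t_1:A_1^\oplus$ and $\Gamma\vdash t_2:A_2^\oplus$, then $\pi_i^{\mathcal C}(\langle t_1,t_2\rangle^{\mathcal C})\to^*t_i$. 2. If $\Gamma\vdash t:A_i^\oplus$ and $\Gamma,x:A_j^\oplus\vdash s_j:C^\oplus$ for $j=1,2$, then $\delta^{\mathcal C}(\mathsf{in}_i^{\mathcal C}(t))[_{x:A_1^\oplus}.s_1][_{x:A_2^\oplus}.s_2]\to^*s_i[x:=t]$. 3. If $\Gamma,x:A^\oplus\vdash t:B^\oplus$ and $\Gamma\vdash s:A^\oplus$, then $(\lambda^{\mathcal C}_{x}.t)\,@^{\mathcal C}\,s\to^*t[x:=s]$. 4. If $\Gamma,x:A^\oplus\vdash s_1:C^\oplus$ and $\Gamma,x:(\neg A)^\oplus\vdash s_2:C^\oplus$, then $$\delta^{\mathcal C}\,\pitchfork^{\mathcal C}_A[_{x:A^\oplus}.s_1][_{x:(\neg A)^\oplus}.s_2]\ \to^*\ \mathsf{IC}^+_{(y:C^\ominus)}.\big(s_2[x:=s_1^*]\bullet^+y\big),$$ where $s_1^*=\mathsf{IC}^+_{(\_:(\neg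 A)^\ominus)}.\,\nu^+\big(\mathsf{IC}^-_{(x:A^\oplus)}.(s_1\bowtie_{A^- }y)\big)$ and $y$ is fresh.
   Context: **Types.** Fix a denumerable set of propositional variables $\alpha$. Pure propositions: $A,B,C ::= \alpha \mid A\land B\mid A\lor B\mid \neg A$. Types (moded propositions): $P,Q ::= A^+\mid A^-\mid A^\oplus\mid A^\ominus$; $A^+,A^-$ are strong, $A^\oplus,A^\ominus$ classical. Opposite: $(A^+)^\sim=A^-$, $(A^-)^\sim=A^+$, $(A^\oplus)^\sim=A^\ominus$, $(A^\ominus)^\sim=A^\oplus$. **Terms of $\lambda^{\textsc{prk}}$.** ($i\in\{1,2\}$, $\pm\in\{+,-\}$; $x,y$ from a denumerable set of variables) $$t,s,u ::= x \mid t\blacktriangleright\!\blacktriangleleft_P s\mid \langle t,s\rangle^\pm\mid \pi_i^\pm(t)\mid \mathsf{in}_i^\pm(t)\mid \delta^\pm t[_{x:P}.s][_{y:Q}.u]\mid \nu^\pm t\mid \mu^\pm t\mid \mathsf{IC}^\pm_{(x:P)}.t\mid t\bullet^\pm s.$$ In $\delta^\pm t[_{x:P}.s][_{y:Q}.u]$, $x$ is bound in $s$ and $y$ in $u$; in $\mathsf{IC}^\pm_{(x:P)}.t$, $x$ is bound in $t$. Terms are taken modulo $\alpha$-renaming; $t[x:=s]$ is capture-avoiding substitution. Type annotations may be omitted; "$\_$" denotes an unused bound variable. **Typing.** Typing contexts $\Gamma$ are finite lists $x_1:P_1,\dots,x_n:P_n$ with distinct variables, up to reordering. Rules: - (Ax)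 $\Gamma,x:P\vdash x:P$. (Abs) $\Gamma\vdash t:P$, $\Gamma\vdash s:P^\sim$, $P$ strong $\Rightarrow$ $\Gamma\vdash t\blacktriangleright\!\blacktriangleleft_Q s:Q$. - $\Gamma\vdash t:A^\oplus$, $\Gamma\vdash s:B^\oplus$ $\Rightarrow$ $\Gamma\vdash\langle t,s\rangle^+:(A\land B)^+$. $\Gamma\vdash t:A^\ominus$, $\Gamma\vdash s:B^\ominus$ $\Rightarrow$ $\Gamma\vdash\langle t,s\rangle^-:(A\lor B)^-$. - $\Gamma\vdash t:(A_1\land A_2)^+$ $\Rightarrow$ $\Gamma\vdash\pi^+_i(t):A_i^\oplus$. $\Gamma\vdash t:(A_1\lor A_2)^-$ $\Rightarrow$ $\Gamma\vdash\pi^-_i(t):A_i^\ominus$. - $\Gamma\vdash t:A_i^\oplus$ $\Rightarrow$ $\Gamma\vdash\mathsf{in}^+_i(t):(A_1\lor A_2)^+$. $\Gamma\vdash t:A_i^\ominus$ $\Rightarrow$ $\Gamma\vdash\mathsf{in}^-_i(t):(A_1\land A_2)^-$. - $\Gamma\vdash t:(A\lor B)^+$, $\Gamma,x:A^\oplus\vdash s:P$, $\Gamma,y:B^\oplus\vdash u:P$ $\Rightarrow$ $\Gamma\vdash\delta^+t[_{x:A^\oplus}.s][_{y:B^\oplus}.u]:P$. $\Gamma\vdash t:(A\land B)^-$, $\Gamma,x:A^\ominus\vdash s:P$, $\Gamma,y:B^\ominus\vdash u:P$ $\Rightarrow$ $\Gamma\vdash\delta^-t[_{x:A^\ominus}.s][_{y:B^\ominus}.u]:P$.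 - $\Gamma\vdash t:A^\ominus$ $\Rightarrow$ $\Gamma\vdash\nu^+t:(\neg A)^+$. $\Gamma\vdash t:A^\oplus$ $\Rightarrow$ $\Gamma\vdash\nu^-t:(\neg A)^-$. $\Gamma\vdash t:(\neg A)^+$ $\Rightarrow$ $\Gamma\vdash\mu^+t:A^\ominus$. $\Gamma\vdash t:(\neg A)^-$ $\Rightarrow$ $\Gamma\vdash\mu^-t:A^\oplus$. - $\Gamma,x:A^\ominus\vdash t:A^+$ $\Rightarrow$ $\Gamma\vdash\mathsf{IC}^+_{(x:A^\ominus)}.t:A^\oplus$. $\Gamma,x:A^\oplus\vdash t:A^-$ $\Rightarrow$ $\Gamma\vdash\mathsf{IC}^-_{(x:A^\oplus)}.t:A^\ominus$. - $\Gamma\vdash t:A^\oplus$, $\Gamma\vdash s:A^\ominus$ $\Rightarrow$ $\Gamma\vdash t\bullet^+s:A^+$. $\Gamma\vdash t:A^\ominus$, $\Gamma\vdash s:A^\oplus$ $\Rightarrow$ $\Gamma\vdash t\bullet^-s:A^-$. **Generalized absurdity.** For $t:P$ and $s:P^\sim$, $t\bowtie_Q s$ denotes: $t\blacktriangleright\!\blacktriangleleft_Q s$ if $P$ is strong; $(t\bullet^+s)\blacktriangleright\!\blacktriangleleft_Q(s\bullet^-t)$ if $P=A^\oplus$; $(t\bullet^-s)\blacktriangleright\!\blacktriangleleft_Q(s\bullet^+t)$ if $P=A^\ominus$. **Reduction of $\lambda^{\textsc{prk}}_\eta$.** Defined on typable terms as the closure under arbitrary contexts of (in each rule all $\pm$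 denote the same sign, $\mp$ the opposite sign, and $i\in\{1,2\}$): - $\pi_i^\pm(\langle t_1,t_2\rangle^\pm)\to t_i$; - $\delta^\pm(\mathsf{in}_i^\pm(t))[_x.s_1][_x.s_2]\to s_i[x:=t]$; - $\mu^\pm(\nu^\pm t)\to t$; - $(\mathsf{IC}^\pm_x.t)\bullet^\pm s\to t[x:=s]$; - $\langle t_1,t_2\rangle^\pm\blacktriangleright\!\blacktriangleleft_Q\mathsf{in}_i^\mp(s)\to t_i\bowtie_Q s$; - $\mathsf{in}_i^\pm(t)\blacktriangleright\!\blacktriangleleft_Q\langle s_1,s_2\rangle^\mp\to t\bowtie_Q s_i$; - $(\nu^\pm t)\blacktriangleright\!\blacktriangleleft_Q(\nu^\mp s)\to t\bowtie_Q s$; - ($\eta$) $\mathsf{IC}^\pm_x.(t\bullet^\pm x)\to t$ if $x$ is not free in $t$. **Derived terms.** All bound variables introduced below are chosen fresh. - Contraposition: if $\Gamma,x:A^\oplus\vdash t:Q$, then $\updownarrow_x^y(t):=\mathsf{IC}^-_{(x:A^\oplus)}.(t\bowtie_{A^- }y)$, where $y:Q^\sim$; it has type $A^\ominus$ in $\Gamma,y:Q^\sim$. - For $t:A^\oplus$, $s:B^\oplus$: $\langle t,s\rangle^{\mathcal C}:=\mathsf{IC}^+_{(\_:(A\land B)^\ominus)}.\langle t,s\rangle^+$, of type $(A\land B)^\oplus$. - For $t:(A_1\land A_2)^\oplus$: $\pi_i^{\mathcal C}(t):=\mathsf{IC}^+_{(x:A_i^\ominus)}.\,\pi_i^+\big(t\bullet^+\mathsf{IC}^-_{(\_:(A_1\land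 A_2)^\oplus)}.\mathsf{in}_i^-(x)\big)\bullet^+x$, of type $A_i^\oplus$. - For $t:A_i^\oplus$: $\mathsf{in}_i^{\mathcal C}(t):=\mathsf{IC}^+_{(\_:(A_1\lor A_2)^\ominus)}.\mathsf{in}_i^+(t)$, of type $(A_1\lor A_2)^\oplus$. - For $\Gamma\vdash t:(A\lor B)^\oplus$, $\Gamma,x:A^\oplus\vdash s:C^\oplus$, $\Gamma,x:B^\oplus\vdash u:C^\oplus$: $\delta^{\mathcal C}t[_{x:A^\oplus}.s][_{x:B^\oplus}.u]$ is the term of type $C^\oplus$ $$\mathsf{IC}^+_{(y:C^\ominus)}.\ \delta^+\big(t\bullet^+\mathsf{IC}^-_{(\_:(A\lor B)^\oplus)}.\langle\updownarrow_x^y(s),\updownarrow_x^y(u)\rangle^-\big)[_{x:A^\oplus}.\,s\bullet^+y][_{x:B^\oplus}.\,u\bullet^+y].$$ - Excluded middle: $\pitchfork^{\mathcal C}_A$ is the closed term of type $(A\lor\neg A)^\oplus$ $$\mathsf{IC}^+_{(x:(A\lor\neg A)^\ominus)}.\,\mathsf{in}_2^+\big(\mathsf{IC}^+_{(y:(\neg A)^\ominus)}.\,\nu^+\pi_1^-(x\bullet^-\Delta_y)\big),$$ $$\Delta_y:=\mathsf{IC}^+_{(\_:(A\lor\neg A)^\ominus)}.\,\mathsf{in}_1^+\big(\mathsf{IC}^+_{(z:A^\ominus)}.(y\bowtie_{A^+}\mathsf{IC}^+_{(\_:(\neg A)^\ominus)}.\nu^+z)\big).$$ - Implication is the abbreviation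 $A\Rightarrow B:=\neg A\lor B$. For $\Gamma,x:A^\oplus\vdash t:B^\oplus$, $\lambda^{\mathcal C}_x.t:=\mathsf{IC}^+_{(y:(A\Rightarrow B)^\ominus)}.\,\mathsf{in}_2^+(t[x:=\mathbf X_y])$, of type $(A\Rightarrow B)^\oplus$, where $$\mathbf X_y:=\mathsf{IC}^+_{(z:A^\ominus)}.\ \mu^-\big(\mathbf X'_{y,z}\bullet^-\mathsf{IC}^+_{(\_:(\neg A)^\ominus)}.\nu^+z\big)\bullet^+z,$$ $$\mathbf X'_{y,z}:=\pi_1^-\big(y\bullet^-\mathsf{IC}^+_{(\_:(A\Rightarrow B)^\ominus)}.\,\mathsf{in}_1^+(\mathsf{IC}^+_{(\_:(\neg A)^\ominus)}.\nu^+z)\big).$$ - For $t:(A\Rightarrow B)^\oplus$ and $s:A^\oplus$, $t\,@^{\mathcal C}\,s$ is the term of type $B^\oplus$ $$\mathsf{IC}^+_{(x:B^\ominus)}.\ \delta^+\big(t\bullet^+\mathsf{IC}^-_{(\_:(A\Rightarrow B)^\oplus)}.\langle\mathsf{IC}^-_{(\_:(\neg A)^\oplus)}.\nu^-s,\ x\rangle^-\big)\big[_{y:(\neg A)^\oplus}.\ s\bowtie_{B^+}\mu^+(y\bullet^+\mathsf{IC}^-_{(\_:(\neg A)^\oplus)}.\nu^-s)\big]\big[_{z:B^\oplus}.\ z\bullet^+x\big].$$ -}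

module Defs where

open import Data.Fin.Base using (Fin; zero; suc)
open import Data.Fin.Patterns using (0F; 1F)
open import Data.Fin.Substitution
  using (Sub; Lift; TermSubst; module Lift; module VarSubst)
open import Data.Nat.Base using (ℕ; zero; suc)
open import Data.Product.Base using (∃; _×_)
open import Data.Sign.Base using (Sign; +; -; opposite)
open import Data.Vec.Base using (Vec; _∷_; lookup)
open import Relation.Binary.Construct.Closure.ReflexiveTransitive using (Star)

infix  9 ¬_
infixr 8 _∧_
infixr 7 _∨_
infixr 6 _⇒_

data Prp : Set where
  atom    : ℕ → Prp
  _∧_ _∨_ : Prp → Prp → Prp
  ¬_      : Prp → Prp

_⇒_ : Prp → Prp → Prp
A ⇒ B = ¬ A ∨ B

infix 5 _⁺ _⁻ _⊕ _⊖
infix 6 _~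

data Type : Set where
  _⁺ _⁻ _⊕ _⊖ : Prp → Type

data Strong : Type → Set where
  strong⁺ : ∀ {A} → Strong (A ⁺)
  strong⁻ : ∀ {A} → Strong (A ⁻)

_~ : Type → Type
(A ⁺) ~ = A ⁻
(A ⁻) ~ = A ⁺
(A ⊕) ~ = A ⊖
(A ⊖) ~ = A ⊕

-- The index set {1,2} is Fin 2, with 0F standing for 1 and 1F for 2.
pick : {X : Set} → Fin 2 → X → X → X
pick 0F x₁ x₂ = x₁
pick 1F x₁ x₂ = x₂

-- Raw terms up to α-renaming: well-scoped de Bruijn terms.  `IC` binds one
-- variable, annotated with its type; in  δ σ t P s Q u  the terms s and u bind
-- one variable each, of types P and Q respectively.
infix 7 _▶◀[_]_ _•[_]_

data Tm (n : ℕ) : Set where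
  var     : Fin n → Tm n
  _▶◀[_]_ : Tm n → Type → Tm n → Tm n
  pair    : Sign → Tm n → Tm n → Tm n
  π       : Sign → Fin 2 → Tm n → Tm n
  inj     : Sign → Fin 2 → Tm n → Tm n
  δ       : Sign → Tm n → Type → Tm (suc n) → Type → Tm (suc n) → Tm n
  ν μ     : Sign → Tm n → Tm n
  IC      : Sign → Type → Tm (suc n) → Tm n
  _•[_]_  : Tm n → Sign → Tm n → Tm n

module _ {T : ℕ → Set} (l : Lift T Tm) where
  open Lift l hiding (var)

  app : ∀ {m n} → Tm m → Sub T m n → Tm n
  app (var x)         ρ = lift (lookup ρ x)
  app (t ▶◀[ Q ] s)   ρ = app t ρ ▶◀[ Q ] app s ρ
  app (pair σ t s)    ρ = pair σ (app t ρ) (app s ρ)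
  app (π σ i t)       ρ = π σ i (app t ρ)
  app (inj σ i t)     ρ = inj σ i (app t ρ)
  app (δ σ t P s Q u) ρ = δ σ (app t ρ) P (app s (ρ ↑)) Q (app u (ρ ↑))
  app (ν σ t)         ρ = ν σ (app t ρ)
  app (μ σ t)         ρ = μ σ (app t ρ)
  app (IC σ P t)      ρ = IC σ P (app t (ρ ↑))
  app (t •[ σ ] s)    ρ = app t ρ •[ σ ] app s ρ

tmSubst : TermSubst Tm
tmSubst = record { var = var; app = app }

-- `t / sub s` is t[x:=s], where x is the innermost variable of t.
open TermSubst tmSubst public using (_/_; _/Var_; sub; weaken)

-- Weakening by a fresh variable placed just outside the innermost one.
weaken₁ : ∀ {n} → Tm (suc n) → Tm (suc (suc n))
weaken₁ t = t /Var (VarSubst.wk VarSubst.↑)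

-- The context  Γ, x : P  is  P ∷ Γ.
Ctx : ℕ → Set
Ctx n = Vec Type n

infix 4 _⊢_∶_

data _⊢_∶_ {n} (Γ : Ctx n) : Tm n → Type → Set where
  ⊢var : ∀ x → Γ ⊢ var x ∶ lookup Γ x
  ⊢abs : ∀ {P Q t s} → Strong P →
         Γ ⊢ t ∶ P → Γ ⊢ s ∶ P ~ → Γ ⊢ t ▶◀[ Q ] s ∶ Q
  ⊢pair⁺ : ∀ {A B t s} →
           Γ ⊢ t ∶ A ⊕ → Γ ⊢ s ∶ B ⊕ → Γ ⊢ pair + t s ∶ (A ∧ B) ⁺
  ⊢pair⁻ : ∀ {A B t s} →
           Γ ⊢ t ∶ A ⊖ → Γ ⊢ s ∶ B ⊖ → Γ ⊢ pair - t s ∶ (A ∨ B) ⁻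
  ⊢π⁺ : ∀ {A₁ A₂ t} i → Γ ⊢ t ∶ (A₁ ∧ A₂) ⁺ → Γ ⊢ π + i t ∶ pick i A₁ A₂ ⊕
  ⊢π⁻ : ∀ {A₁ A₂ t} i → Γ ⊢ t ∶ (A₁ ∨ A₂) ⁻ → Γ ⊢ π - i t ∶ pick i A₁ A₂ ⊖
  ⊢inj⁺ : ∀ {A₁ A₂ t} i → Γ ⊢ t ∶ pick i A₁ A₂ ⊕ → Γ ⊢ inj + i t ∶ (A₁ ∨ A₂) ⁺
  ⊢inj⁻ : ∀ {A₁ A₂ t} i → Γ ⊢ t ∶ pick i A₁ A₂ ⊖ → Γ ⊢ inj - i t ∶ (A₁ ∧ A₂) ⁻
  ⊢δ⁺ : ∀ {A B P t s u} → Γ ⊢ t ∶ (A ∨ B) ⁺ →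
        (A ⊕) ∷ Γ ⊢ s ∶ P → (B ⊕) ∷ Γ ⊢ u ∶ P → Γ ⊢ δ + t (A ⊕) s (B ⊕) u ∶ P
  ⊢δ⁻ : ∀ {A B P t s u} → Γ ⊢ t ∶ (A ∧ B) ⁻ →
        (A ⊖) ∷ Γ ⊢ s ∶ P → (B ⊖) ∷ Γ ⊢ u ∶ P → Γ ⊢ δ - t (A ⊖) s (B ⊖) u ∶ P
  ⊢ν⁺ : ∀ {A t} → Γ ⊢ t ∶ A ⊖ → Γ ⊢ ν + t ∶ (¬ A) ⁺
  ⊢ν⁻ : ∀ {A t} → Γ ⊢ t ∶ A ⊕ → Γ ⊢ ν - t ∶ (¬ A) ⁻
  ⊢μ⁺ : ∀ {A t} → Γ ⊢ t ∶ (¬ A) ⁺ → Γ ⊢ μ + t ∶ A ⊖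
  ⊢μ⁻ : ∀ {A t} → Γ ⊢ t ∶ (¬ A) ⁻ → Γ ⊢ μ - t ∶ A ⊕
  ⊢IC⁺ : ∀ {A t} → (A ⊖) ∷ Γ ⊢ t ∶ A ⁺ → Γ ⊢ IC + (A ⊖) t ∶ A ⊕
  ⊢IC⁻ : ∀ {A t} → (A ⊕) ∷ Γ ⊢ t ∶ A ⁻ → Γ ⊢ IC - (A ⊕) t ∶ A ⊖
  ⊢•⁺ : ∀ {A t s} → Γ ⊢ t ∶ A ⊕ → Γ ⊢ s ∶ A ⊖ → Γ ⊢ t •[ + ] s ∶ A ⁺
  ⊢•⁻ : ∀ {A t s} → Γ ⊢ t ∶ A ⊖ → Γ ⊢ s ∶ A ⊕ → Γ ⊢ t •[ - ] s ∶ A ⁻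

-- `t ⦂ P ⋈[ Q ] s` is generalized absurdity t ⋈_Q s for t : P and s : P ~.
infix 7 _⦂_⋈[_]_

_⦂_⋈[_]_ : ∀ {n} → Tm n → Type → Type → Tm n → Tm n
t ⦂ A ⁺ ⋈[ Q ] s = t ▶◀[ Q ] s
t ⦂ A ⁻ ⋈[ Q ] s = t ▶◀[ Q ] s
t ⦂ A ⊕ ⋈[ Q ] s = (t •[ + ] s) ▶◀[ Q ] (s •[ - ] t)
t ⦂ A ⊖ ⋈[ Q ] s = (t •[ - ] s) ▶◀[ Q ] (s •[ + ] t)

-- The context-closed rules.  The relation is indexed by Γ because the type P
-- selecting the form of ⋈ in a contractum is a type of the given subterm in Γ.
infix 4 _⊢_⇝_ _⊢_⟶_ _⊢_⟶*_

data _⊢_⇝_ {n} (Γ : Ctx n) : Tm n → Tm n → Set where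
  β-π  : ∀ {σ t₁ t₂} i → Γ ⊢ π σ i (pair σ t₁ t₂) ⇝ pick i t₁ t₂
  β-δ  : ∀ {σ t P s₁ Q s₂} i →
         Γ ⊢ δ σ (inj σ i t) P s₁ Q s₂ ⇝ pick i s₁ s₂ / sub t
  β-μ  : ∀ {σ t} → Γ ⊢ μ σ (ν σ t) ⇝ t
  β-IC : ∀ {σ P t s} → Γ ⊢ IC σ P t •[ σ ] s ⇝ t / sub s
  pair-inj : ∀ {σ t₁ t₂ s P Q} i →
             Γ ⊢ pick i t₁ t₂ ∶ P → Γ ⊢ s ∶ P ~ →
             Γ ⊢ pair σ t₁ t₂ ▶◀[ Q ] inj (opposite σ) i s
               ⇝ pick i t₁ t₂ ⦂ P ⋈[ Q ] s
  inj-pair : ∀ {σ t s₁ s₂ P Q} i →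
             Γ ⊢ t ∶ P → Γ ⊢ pick i s₁ s₂ ∶ P ~ →
             Γ ⊢ inj σ i t ▶◀[ Q ] pair (opposite σ) s₁ s₂
               ⇝ t ⦂ P ⋈[ Q ] pick i s₁ s₂
  ν-ν : ∀ {σ t s P Q} → Γ ⊢ t ∶ P → Γ ⊢ s ∶ P ~ →
        Γ ⊢ ν σ t ▶◀[ Q ] ν (opposite σ) s ⇝ t ⦂ P ⋈[ Q ] s
  η-IC : ∀ {σ P t} → Γ ⊢ IC σ P (weaken t •[ σ ] var zero) ⇝ t

  ξ-abs₁  : ∀ {Q t t′ s} → Γ ⊢ t ⇝ t′ → Γ ⊢ t ▶◀[ Q ] s ⇝ t′ ▶◀[ Q ] s
  ξ-abs₂  : ∀ {Q t s s′} → Γ ⊢ s ⇝ s′ → Γ ⊢ t ▶◀[ Q ] s ⇝ t ▶◀[ Q ] s′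
  ξ-pair₁ : ∀ {σ t t′ s} → Γ ⊢ t ⇝ t′ → Γ ⊢ pair σ t s ⇝ pair σ t′ s
  ξ-pair₂ : ∀ {σ t s s′} → Γ ⊢ s ⇝ s′ → Γ ⊢ pair σ t s ⇝ pair σ t s′
  ξ-π     : ∀ {σ i t t′} → Γ ⊢ t ⇝ t′ → Γ ⊢ π σ i t ⇝ π σ i t′
  ξ-inj   : ∀ {σ i t t′} → Γ ⊢ t ⇝ t′ → Γ ⊢ inj σ i t ⇝ inj σ i t′
  ξ-δ     : ∀ {σ t t′ P s Q u} → Γ ⊢ t ⇝ t′ →
            Γ ⊢ δ σ t P s Q u ⇝ δ σ t′ P s Q u
  ξ-δ₁    : ∀ {σ t P s s′ Q u} → P ∷ Γ ⊢ s ⇝ s′ →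
            Γ ⊢ δ σ t P s Q u ⇝ δ σ t P s′ Q u
  ξ-δ₂    : ∀ {σ t P s Q u u′} → Q ∷ Γ ⊢ u ⇝ u′ →
            Γ ⊢ δ σ t P s Q u ⇝ δ σ t P s Q u′
  ξ-ν     : ∀ {σ t t′} → Γ ⊢ t ⇝ t′ → Γ ⊢ ν σ t ⇝ ν σ t′
  ξ-μ     : ∀ {σ t t′} → Γ ⊢ t ⇝ t′ → Γ ⊢ μ σ t ⇝ μ σ t′
  ξ-IC    : ∀ {σ P t t′} → P ∷ Γ ⊢ t ⇝ t′ → Γ ⊢ IC σ P t ⇝ IC σ P t′
  ξ-•₁    : ∀ {σ t t′ s} → Γ ⊢ t ⇝ t′ → Γ ⊢ t •[ σ ] s ⇝ t′ •[ σ ] s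
  ξ-•₂    : ∀ {σ t s s′} → Γ ⊢ s ⇝ s′ → Γ ⊢ t •[ σ ] s ⇝ t •[ σ ] s′

-- Reduction is defined on typable terms only.
_⊢_⟶_ : ∀ {n} → Ctx n → Tm n → Tm n → Set
Γ ⊢ t ⟶ s = (∃ λ P → Γ ⊢ t ∶ P) × Γ ⊢ t ⇝ s

_⊢_⟶*_ : ∀ {n} → Ctx n → Tm n → Tm n → Set
Γ ⊢ t ⟶* s = Star (Γ ⊢_⟶_) t s

-- Contraposition ↕ˣ_y(t), for t : Q with innermost variable x : A ⊕.  In the
-- result x has been replaced by y : Q ~ as the innermost free variable.
↕ : ∀ {n} → Prp → Type → Tm (suc n) → Tm (suc n)
↕ A Q t = IC - (A ⊕) (weaken₁ t ⦂ Q ⋈[ A ⁻ ] var 1F)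

-- The propositions occurring in type annotations are explicit arguments.
pairᶜ : ∀ {n} → Prp → Prp → Tm n → Tm n → Tm n
pairᶜ A B t s = IC + ((A ∧ B) ⊖) (pair + (weaken t) (weaken s))

πᶜ : ∀ {n} → Fin 2 → Prp → Prp → Tm n → Tm n
πᶜ i A₁ A₂ t =
  IC + (pick i A₁ A₂ ⊖)
    (π + i (weaken t •[ + ] IC - ((A₁ ∧ A₂) ⊕) (inj - i (var 1F)))
      •[ + ] var 0F)

injᶜ : ∀ {n} → Fin 2 → Prp → Prp → Tm n → Tm n
injᶜ i A₁ A₂ t = IC + ((A₁ ∨ A₂) ⊖) (inj + i (weaken t))

δᶜ : ∀ {n} (A B C : Prp) → Tm n → Tm (suc n) → Tm (suc n) → Tm n
δᶜ A B C t s u =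
  IC + (C ⊖)
    (δ + (weaken t •[ + ]
            IC - ((A ∨ B) ⊕)
              (pair - (weaken (↕ A (C ⊕) s)) (weaken (↕ B (C ⊕) u))))
      (A ⊕) (weaken₁ s •[ + ] var 1F)
      (B ⊕) (weaken₁ u •[ + ] var 1F))

-- Δ_y, for a variable y : (¬ A) ⊖.
Δ : ∀ {n} → Prp → Fin n → Tm n
Δ A y =
  IC + ((A ∨ ¬ A) ⊖)
    (inj + 0F
      (IC + (A ⊖)
        (var (suc (suc y)) ⦂ (¬ A) ⊖ ⋈[ A ⁺ ]
           IC + ((¬ A) ⊖) (ν + (var 1F)))))

⋔ᶜ : ∀ {n} → Prp → Tm n
⋔ᶜ A =
  IC + ((A ∨ ¬ A) ⊖)
    (inj + 1F
      (IC + ((¬ A) ⊖)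
        (ν + (π - 0F (var 1F •[ - ] Δ A 0F)))))

-- X′_{y,z} and X_y, for variables y : (A ⇒ B) ⊖ and z : A ⊖.
X′ : ∀ {n} → Prp → Prp → Fin n → Fin n → Tm n
X′ A B y z =
  π - 0F
    (var y •[ - ]
      IC + ((A ⇒ B) ⊖)
        (inj + 0F (IC + ((¬ A) ⊖) (ν + (var (suc (suc z)))))))

X : ∀ {n} → Prp → Prp → Fin n → Tm n
X A B y =
  IC + (A ⊖)
    (μ - (X′ A B (suc y) 0F •[ - ] IC + ((¬ A) ⊖) (ν + (var 1F)))
      •[ + ] var 0F)

ƛᶜ : ∀ {n} → Prp → Prp → Tm (suc n) → Tm n
ƛᶜ A B t = IC + ((A ⇒ B) ⊖) (inj + 1F (weaken₁ t / sub (X A B 0F)))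

appᶜ : ∀ {n} → Prp → Prp → Tm n → Tm n → Tm n
appᶜ A B t s =
  IC + (B ⊖)
    (δ + (weaken t •[ + ]
            IC - ((A ⇒ B) ⊕)
              (pair - (IC - ((¬ A) ⊕) (ν - (weaken (weaken (weaken s)))))
                      (var 1F)))
      ((¬ A) ⊕) (weaken (weaken s) ⦂ A ⊕ ⋈[ B ⁺ ]
                  μ + (var 0F •[ + ]
                         IC - ((¬ A) ⊕) (ν - (weaken (weaken (weaken s))))))
      (B ⊕) (var 0F •[ + ] var 1F))

-- s₁*, for s₁ : C ⊕ with innermost variable x : A ⊕.  In the result x has been
-- replaced by y : C ⊖ as the innermost free variable.
star : ∀ {n} → Prp → Prp → Tm (suc n) → Tm (suc n)
star A C s₁ =
  IC + ((¬ A) ⊖)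
    (ν + (weaken (IC - (A ⊕) (weaken₁ s₁ ⦂ C ⊕ ⋈[ A ⁻ ] var 1F))))

{-# OPTIONS --safe #-}

-- In each part β-reduction at the head exposes an elimination of an
-- introduction, and the outermost classical abstraction is finally removed by η
-- (except in part 4, where y also occurs in s₁*).  The absurdity rules never
-- fire.  In parts 3 and 4 β-reduction substitutes for x a term that is itself a
-- redex (X_y resp. the second disjunct of ⋔ᶜ, with y resp. the bound variable of
-- ⋔ᶜ instantiated), and its reduction to s resp. s₁* has to be performed inside
-- all substituted copies.  Since reduction is restricted to typable terms, the
-- chains are built on raw terms and typability of the intermediate terms comes
-- from preservation.
module Submission where

open import Defs
open import Data.Fin.Base using (Fin; zero; suc)
open import Data.Fin.Patterns using (0F; 1F; 2F)
open import Data.Fin.Substitution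
  using (Sub; Subs; Lift; TermSubst; module VarSubst)
open import Data.Fin.Substitution.Lemmas using (TermLemmas; module VarLemmas)
open import Data.Nat.Base using (ℕ; suc)
open import Data.Product.Base using (_×_; _,_)
open import Data.Sign.Base using (+; -)
open import Data.Vec.Base using (_∷_; lookup; map)
open import Data.Vec.Properties using (lookup-map)
open import Function.Base using (_∘_; id)
open import Relation.Binary.Construct.Closure.ReflexiveTransitive
  using (Star; ε; _◅_; _◅◅_; gmap)
open import Relation.Binary.PropositionalEquality
  using (_≡_; refl; sym; trans; cong; cong₂; subst; module ≡-Reasoning)

open TermSubst tmSubst using (varLift; termLift; module Lifted; _↑; _⊙_; wk)

-- Substitution lemmas for the term syntax.

module _ {T : ℕ → Set} (l : Lift T Tm) where
  open Lifted l using (_↑✶_; _/✶_)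

  -- Stated for any `f` that commutes with `app`, so that one induction on the sequence serves `π`,
  -- `inj`, `ν` and `μ` with their signs and indices fixed. The binders `δ` and `IC` are treated
  -- separately, since there `k` becomes `suc k`.
  unary-/✶-↑✶ : (f : ∀ {n} → Tm n → Tm n) →
                (∀ {m n} t (ρ : Sub T m n) → app l (f t) ρ ≡ f (app l t ρ)) →
                ∀ k {m n t} (ρs : Subs T m n) →
                f t /✶ ρs ↑✶ k ≡ f (t /✶ ρs ↑✶ k)
  unary-/✶-↑✶ f f-app k ε        = refl
  unary-/✶-↑✶ f f-app k (ρ ◅ ρs) =
    trans (cong (λ t → app l t _) (unary-/✶-↑✶ f f-app k ρs)) (f-app _ _)

  binary-/✶-↑✶ : (f : ∀ {n} → Tm n → Tm n → Tm n) →
                 (∀ {m n} t s (ρ : Sub T m n) →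
                  app l (f t s) ρ ≡ f (app l t ρ) (app l s ρ)) →
                 ∀ k {m n t s} (ρs : Subs T m n) →
                 f t s /✶ ρs ↑✶ k ≡ f (t /✶ ρs ↑✶ k) (s /✶ ρs ↑✶ k)
  binary-/✶-↑✶ f f-app k ε        = refl
  binary-/✶-↑✶ f f-app k (ρ ◅ ρs) =
    trans (cong (λ t → app l t _) (binary-/✶-↑✶ f f-app k ρs)) (f-app _ _ _)

  δ-/✶-↑✶ : ∀ k {m n σ t P s Q u} (ρs : Subs T m n) →
            δ σ t P s Q u /✶ ρs ↑✶ k ≡
            δ σ (t /✶ ρs ↑✶ k) P (s /✶ ρs ↑✶ suc k) Q (u /✶ ρs ↑✶ suc k)
  δ-/✶-↑✶ k ε        = refl
  δ-/✶-↑✶ k (ρ ◅ ρs) = cong (λ t → app l t _) (δ-/✶-↑✶ k ρs)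

  IC-/✶-↑✶ : ∀ k {m n σ P t} (ρs : Subs T m n) →
             IC σ P t /✶ ρs ↑✶ k ≡ IC σ P (t /✶ ρs ↑✶ suc k)
  IC-/✶-↑✶ k ε        = refl
  IC-/✶-↑✶ k (ρ ◅ ρs) = cong (λ t → app l t _) (IC-/✶-↑✶ k ρs)

-- All substitution identities used later follow from one fact: two sequences of substitutions,
-- possibly one of renamings and one of terms, agree on all terms once they agree on variables.
-- Agreement is assumed under every number `k` of binders, which is what lets the induction on the
-- term pass below `δ` and `IC`.
tmLemmas : TermLemmas Tm
tmLemmas = record { termSubst = tmSubst ; app-var = refl ; /✶-↑✶ = /✶-↑✶ }
  where
  module _ {T₁ T₂ : ℕ → Set} {l₁ : Lift T₁ Tm} {l₂ : Lift T₂ Tm} where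
    open Lifted l₁ using () renaming (_↑✶_ to _↑✶₁_; _/✶_ to _/✶₁_)
    open Lifted l₂ using () renaming (_↑✶_ to _↑✶₂_; _/✶_ to _/✶₂_)

    /✶-↑✶ : ∀ {m n} (ρs₁ : Subs T₁ m n) (ρs₂ : Subs T₂ m n) →
            (∀ k x → var x /✶₁ ρs₁ ↑✶₁ k ≡ var x /✶₂ ρs₂ ↑✶₂ k) →
            ∀ k t → t /✶₁ ρs₁ ↑✶₁ k ≡ t /✶₂ ρs₂ ↑✶₂ k
    /✶-↑✶ ρs₁ ρs₂ hyp = go
      where
      unary : (f : ∀ {n} → Tm n → Tm n) →
              (∀ {m n} t (ρ : Sub T₁ m n) → app l₁ (f t) ρ ≡ f (app l₁ t ρ)) →
              (∀ {m n} t (ρ : Sub T₂ m n) → app l₂ (f t) ρ ≡ f (app l₂ t ρ)) →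
              ∀ k {t} → t /✶₁ ρs₁ ↑✶₁ k ≡ t /✶₂ ρs₂ ↑✶₂ k →
              f t /✶₁ ρs₁ ↑✶₁ k ≡ f t /✶₂ ρs₂ ↑✶₂ k
      unary f f₁ f₂ k eq =
        trans (unary-/✶-↑✶ l₁ f f₁ k ρs₁)
          (trans (cong f eq) (sym (unary-/✶-↑✶ l₂ f f₂ k ρs₂)))

      binary : (f : ∀ {n} → Tm n → Tm n → Tm n) →
               (∀ {m n} t s (ρ : Sub T₁ m n) →
                app l₁ (f t s) ρ ≡ f (app l₁ t ρ) (app l₁ s ρ)) →
               (∀ {m n} t s (ρ : Sub T₂ m n) →
                app l₂ (f t s) ρ ≡ f (app l₂ t ρ) (app l₂ s ρ)) →
               ∀ k {t s} → t /✶₁ ρs₁ ↑✶₁ k ≡ t /✶₂ ρs₂ ↑✶₂ k →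
               s /✶₁ ρs₁ ↑✶₁ k ≡ s /✶₂ ρs₂ ↑✶₂ k →
               f t s /✶₁ ρs₁ ↑✶₁ k ≡ f t s /✶₂ ρs₂ ↑✶₂ k
      binary f f₁ f₂ k eq eq′ =
        trans (binary-/✶-↑✶ l₁ f f₁ k ρs₁)
          (trans (cong₂ f eq eq′) (sym (binary-/✶-↑✶ l₂ f f₂ k ρs₂)))

      go : ∀ k t → t /✶₁ ρs₁ ↑✶₁ k ≡ t /✶₂ ρs₂ ↑✶₂ k
      go k (var x)       = hyp k x
      go k (t ▶◀[ Q ] s) =
        binary _▶◀[ Q ]_ (λ _ _ _ → refl) (λ _ _ _ → refl) k (go k t) (go k s)
      go k (pair σ t s)  =
        binary (pair σ) (λ _ _ _ → refl) (λ _ _ _ → refl) k (go k t) (go k s)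
      go k (π σ i t)     = unary (π σ i) (λ _ _ → refl) (λ _ _ → refl) k (go k t)
      go k (inj σ i t)   = unary (inj σ i) (λ _ _ → refl) (λ _ _ → refl) k (go k t)
      go k (δ σ t P s Q u) =
        trans (δ-/✶-↑✶ l₁ k ρs₁)
          (trans (δ-cong (go k t) (go (suc k) s) (go (suc k) u))
            (sym (δ-/✶-↑✶ l₂ k ρs₂)))
        where
        δ-cong : ∀ {n t t′ s s′ u u′} → t ≡ t′ → s ≡ s′ → u ≡ u′ →
                 δ {n} σ t P s Q u ≡ δ σ t′ P s′ Q u′
        δ-cong refl refl refl = refl
      go k (ν σ t)       = unary (ν σ) (λ _ _ → refl) (λ _ _ → refl) k (go k t)
      go k (μ σ t)       = unary (μ σ) (λ _ _ → refl) (λ _ _ → refl) k (go k t)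
      go k (IC σ P t)    =
        trans (IC-/✶-↑✶ l₁ k ρs₁)
          (trans (cong (IC σ P) (go (suc k) t)) (sym (IC-/✶-↑✶ l₂ k ρs₂)))
      go k (t •[ σ ] s)  =
        binary _•[ σ ]_ (λ _ _ _ → refl) (λ _ _ _ → refl) k (go k t) (go k s)

open TermLemmas tmLemmas
  using (/-⊙; /-wk; /Var≡/; ↑≡↑; wk≡wk; lookup-id; lookup-wk; map-weaken-⊙-sub;
         sub-commutes; sub-commutes-with-renaming; weaken-sub; weaken-↑; wk-⊙-∷)

-- Interaction of weakening with instantiation.

weaken-/Var-↑ : ∀ {m n} (t : Tm m) (ρ : Sub Fin m n) →
                weaken t /Var (ρ VarSubst.↑) ≡ weaken (t /Var ρ)
weaken-/Var-↑ t ρ = begin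
  weaken t /Var (ρ VarSubst.↑)     ≡⟨ /Var≡/ {t = weaken t} ⟩
  weaken t / map var (ρ VarSubst.↑) ≡⟨ cong (weaken t /_) ↑≡↑ ⟩
  weaken t / (map var ρ ↑)         ≡⟨ weaken-↑ t ⟩
  weaken (t / map var ρ)           ≡⟨ cong weaken (/Var≡/ {t = t}) ⟨
  weaken (t /Var ρ)                ∎
  where open ≡-Reasoning

weaken₁≡/wk↑ : ∀ {n} (t : Tm (suc n)) → weaken₁ t ≡ t / (wk ↑)
weaken₁≡/wk↑ t = begin
  weaken₁ t                              ≡⟨ /Var≡/ {t = t} ⟩
  t / map var (VarSubst.wk VarSubst.↑)   ≡⟨ cong (t /_) ↑≡↑ ⟩
  t / (map var VarSubst.wk ↑)            ≡⟨ cong (λ ρ → t / (ρ ↑)) wk≡wk ⟩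
  t / (wk ↑)                             ∎
  where open ≡-Reasoning

-- Here `u` may mention the fresh variable, so the two operations do not cancel. They fuse into one
-- parallel substitution, a form in which composites can be compared.
weaken₁-/-sub : ∀ {n} (t : Tm (suc n)) (u : Tm (suc n)) →
                weaken₁ t / sub u ≡ t / (u ∷ wk)
weaken₁-/-sub t u = begin
  weaken₁ t / sub u        ≡⟨ cong (_/ sub u) (weaken₁≡/wk↑ t) ⟩
  t / (wk ↑) / sub u       ≡⟨ /-⊙ t ⟨
  t / ((wk ↑) ⊙ sub u)     ≡⟨ cong (λ ρ → t / (u ∷ ρ)) map-weaken-⊙-sub ⟩
  t / (u ∷ wk)             ∎
  where open ≡-Reasoning

-- This describes contracting an abstraction with a dummy variable that has itself been moved under
-- one more binder: `u` is discarded and only the weakening by that binder survives.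
weaken₁-weaken-/-sub : ∀ {n} (t : Tm n) (u : Tm (suc n)) →
                       weaken₁ (weaken t) / sub u ≡ weaken t
weaken₁-weaken-/-sub t u =
  trans (cong (_/ sub u) (weaken-/Var-↑ t VarSubst.wk)) (weaken-sub (weaken t))

-- The variable instantiated by `v` is absent from the weakened `t`, so `v` can only enter through
-- `u`. For `ƛᶜ` this reads: instantiating y in t[x := X_y] amounts to instantiating it in X_y.
weaken₁-/-sub-/-sub : ∀ {n} (t u : Tm (suc n)) (v : Tm (suc n)) →
                      weaken₁ (weaken₁ t / sub u) / sub v ≡
                      weaken₁ t / sub (weaken₁ u / sub v)
weaken₁-/-sub-/-sub t u v = begin
  weaken₁ (weaken₁ t / sub u) / sub v  ≡⟨ weaken₁-/-sub (weaken₁ t / sub u) v ⟩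
  weaken₁ t / sub u / (v ∷ wk)         ≡⟨ cong (_/ (v ∷ wk)) (weaken₁-/-sub t u) ⟩
  t / (u ∷ wk) / (v ∷ wk)              ≡⟨ /-⊙ t ⟨
  t / ((u ∷ wk) ⊙ (v ∷ wk))            ≡⟨ cong (λ ρ → t / (u / (v ∷ wk) ∷ ρ)) (wk-⊙-∷ v wk) ⟩
  t / (u / (v ∷ wk) ∷ wk)              ≡⟨ cong (λ u′ → t / (u′ ∷ wk)) (weaken₁-/-sub u v) ⟨
  t / (weaken₁ u / sub v ∷ wk)         ≡⟨ weaken₁-/-sub t _ ⟨
  weaken₁ t / sub (weaken₁ u / sub v)  ∎
  where open ≡-Reasoning

-- Typing under renaming and substitution.

-- A typed counterpart of `Lift`, so that one induction on derivations covers both instances. The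
-- instance for variables comes first, because it supplies the weakening of typed terms that the
-- instance for terms requires.
record TypedLift {T : ℕ → Set} (l : Lift T Tm) : Set₁ where
  open Lift l hiding (var; _↑)
  open Lift l using () renaming (var to varᵀ; _↑ to _↑ᵀ)
  infix 4 _⊢ᵀ_∶_
  field
    _⊢ᵀ_∶_   : ∀ {n} → Ctx n → T n → Type → Set
    ⊢ᵀvar    : ∀ {n} {Γ : Ctx n} x → Γ ⊢ᵀ varᵀ x ∶ lookup Γ x
    ⊢ᵀweaken : ∀ {n} {Γ : Ctx n} {t P Q} → Γ ⊢ᵀ t ∶ P → Q ∷ Γ ⊢ᵀ Lift.weaken l t ∶ P
    ⊢lift    : ∀ {n} {Γ : Ctx n} {t P} → Γ ⊢ᵀ t ∶ P → Γ ⊢ lift t ∶ P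

  infix 4 _∶_⇒ˢ_
  _∶_⇒ˢ_ : ∀ {m n} → Sub T m n → Ctx m → Ctx n → Set
  ρ ∶ Γ ⇒ˢ Δ = ∀ x → Δ ⊢ᵀ lookup ρ x ∶ lookup Γ x

  ⊢↑ : ∀ {m n Γ Δ P} {ρ : Sub T m n} → ρ ∶ Γ ⇒ˢ Δ → (ρ ↑ᵀ) ∶ P ∷ Γ ⇒ˢ P ∷ Δ
  ⊢↑ ⊢ρ zero = ⊢ᵀvar zero
  ⊢↑ {ρ = ρ} ⊢ρ (suc x) =
    subst (_ ⊢ᵀ_∶ _) (sym (lookup-map x (Lift.weaken l) ρ)) (⊢ᵀweaken (⊢ρ x))

  ⊢app : ∀ {m n Γ Δ P t} {ρ : Sub T m n} →
         ρ ∶ Γ ⇒ˢ Δ → Γ ⊢ t ∶ P → Δ ⊢ app l t ρ ∶ P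
  ⊢app ⊢ρ (⊢var x)      = ⊢lift (⊢ρ x)
  ⊢app ⊢ρ (⊢abs p t s)  = ⊢abs p (⊢app ⊢ρ t) (⊢app ⊢ρ s)
  ⊢app ⊢ρ (⊢pair⁺ t s)  = ⊢pair⁺ (⊢app ⊢ρ t) (⊢app ⊢ρ s)
  ⊢app ⊢ρ (⊢pair⁻ t s)  = ⊢pair⁻ (⊢app ⊢ρ t) (⊢app ⊢ρ s)
  ⊢app ⊢ρ (⊢π⁺ i t)     = ⊢π⁺ i (⊢app ⊢ρ t)
  ⊢app ⊢ρ (⊢π⁻ i t)     = ⊢π⁻ i (⊢app ⊢ρ t)
  ⊢app ⊢ρ (⊢inj⁺ i t)   = ⊢inj⁺ i (⊢app ⊢ρ t)
  ⊢app ⊢ρ (⊢inj⁻ i t)   = ⊢inj⁻ i (⊢app ⊢ρ t)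
  ⊢app ⊢ρ (⊢δ⁺ t s u)   = ⊢δ⁺ (⊢app ⊢ρ t) (⊢app (⊢↑ ⊢ρ) s) (⊢app (⊢↑ ⊢ρ) u)
  ⊢app ⊢ρ (⊢δ⁻ t s u)   = ⊢δ⁻ (⊢app ⊢ρ t) (⊢app (⊢↑ ⊢ρ) s) (⊢app (⊢↑ ⊢ρ) u)
  ⊢app ⊢ρ (⊢ν⁺ t)       = ⊢ν⁺ (⊢app ⊢ρ t)
  ⊢app ⊢ρ (⊢ν⁻ t)       = ⊢ν⁻ (⊢app ⊢ρ t)
  ⊢app ⊢ρ (⊢μ⁺ t)       = ⊢μ⁺ (⊢app ⊢ρ t)
  ⊢app ⊢ρ (⊢μ⁻ t)       = ⊢μ⁻ (⊢app ⊢ρ t)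
  ⊢app ⊢ρ (⊢IC⁺ t)      = ⊢IC⁺ (⊢app (⊢↑ ⊢ρ) t)
  ⊢app ⊢ρ (⊢IC⁻ t)      = ⊢IC⁻ (⊢app (⊢↑ ⊢ρ) t)
  ⊢app ⊢ρ (⊢•⁺ t s)     = ⊢•⁺ (⊢app ⊢ρ t) (⊢app ⊢ρ s)
  ⊢app ⊢ρ (⊢•⁻ t s)     = ⊢•⁻ (⊢app ⊢ρ t) (⊢app ⊢ρ s)

varTyped : TypedLift varLift
varTyped = record
  { _⊢ᵀ_∶_   = λ Γ x P → lookup Γ x ≡ P
  ; ⊢ᵀvar    = λ _ → refl
  ; ⊢ᵀweaken = id
  ; ⊢lift    = λ { refl → ⊢var _ }
  }

module Renaming = TypedLift varTyped

⊢wkᵛ : ∀ {n} {Γ : Ctx n} {Q} → VarSubst.wk Renaming.∶ Γ ⇒ˢ (Q ∷ Γ)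
⊢wkᵛ {Γ = Γ} {Q} x = cong (lookup (Q ∷ Γ)) (VarLemmas.lookup-wk x)

⊢weaken : ∀ {n} {Γ : Ctx n} {t P Q} → Γ ⊢ t ∶ P → Q ∷ Γ ⊢ weaken t ∶ P
⊢weaken = Renaming.⊢app ⊢wkᵛ

⊢weaken₁ : ∀ {n} {Γ : Ctx n} {t P Q R} →
           R ∷ Γ ⊢ t ∶ P → R ∷ Q ∷ Γ ⊢ weaken₁ t ∶ P
⊢weaken₁ = Renaming.⊢app (Renaming.⊢↑ ⊢wkᵛ)

termTyped : TypedLift termLift
termTyped = record
  { _⊢ᵀ_∶_   = _⊢_∶_
  ; ⊢ᵀvar    = ⊢var
  ; ⊢ᵀweaken = ⊢weaken
  ; ⊢lift    = id
  }

open TypedLift termTyped using (_∶_⇒ˢ_; ⊢↑) renaming (⊢app to ⊢/)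

⊢wk : ∀ {n} {Γ : Ctx n} {Q} → wk ∶ Γ ⇒ˢ (Q ∷ Γ)
⊢wk {Γ = Γ} x = subst (_ ⊢_∶ lookup Γ x) (sym (lookup-wk x)) (⊢var (suc x))

⊢sub : ∀ {n} {Γ : Ctx n} {t P} → Γ ⊢ t ∶ P → sub t ∶ P ∷ Γ ⇒ˢ Γ
⊢sub ⊢t zero    = ⊢t
⊢sub {Γ = Γ} ⊢t (suc x) = subst (_ ⊢_∶ lookup Γ x) (sym (lookup-id x)) (⊢var x)

-- Strengthening and subject reduction.

-- Typing is reflected by renamings because a renamed term keeps its head constructor, which
-- determines the last rule up to the sign. The purpose is η: its redex types the contractum only in
-- weakened form.
⊢unrename : ∀ {m n Γ Δ P} t {ρ : Sub Fin m n} →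
            ρ Renaming.∶ Γ ⇒ˢ Δ → Δ ⊢ t /Var ρ ∶ P → Γ ⊢ t ∶ P
⊢unrename (var x) ⊢ρ (⊢var _) = subst (_ ⊢ var x ∶_) (sym (⊢ρ x)) (⊢var x)
⊢unrename (t ▶◀[ _ ] s) ⊢ρ (⊢abs p ⊢t ⊢s) = ⊢abs p (⊢unrename t ⊢ρ ⊢t) (⊢unrename s ⊢ρ ⊢s)
⊢unrename (pair _ t s) ⊢ρ (⊢pair⁺ ⊢t ⊢s) = ⊢pair⁺ (⊢unrename t ⊢ρ ⊢t) (⊢unrename s ⊢ρ ⊢s)
⊢unrename (pair _ t s) ⊢ρ (⊢pair⁻ ⊢t ⊢s) = ⊢pair⁻ (⊢unrename t ⊢ρ ⊢t) (⊢unrename s ⊢ρ ⊢s)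
⊢unrename (π _ _ t) ⊢ρ (⊢π⁺ i ⊢t) = ⊢π⁺ i (⊢unrename t ⊢ρ ⊢t)
⊢unrename (π _ _ t) ⊢ρ (⊢π⁻ i ⊢t) = ⊢π⁻ i (⊢unrename t ⊢ρ ⊢t)
⊢unrename (inj _ _ t) ⊢ρ (⊢inj⁺ i ⊢t) = ⊢inj⁺ i (⊢unrename t ⊢ρ ⊢t)
⊢unrename (inj _ _ t) ⊢ρ (⊢inj⁻ i ⊢t) = ⊢inj⁻ i (⊢unrename t ⊢ρ ⊢t)
⊢unrename (δ _ t _ s _ u) ⊢ρ (⊢δ⁺ ⊢t ⊢s ⊢u) =
  ⊢δ⁺ (⊢unrename t ⊢ρ ⊢t) (⊢unrename s (Renaming.⊢↑ ⊢ρ) ⊢s) (⊢unrename u (Renaming.⊢↑ ⊢ρ) ⊢u)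
⊢unrename (δ _ t _ s _ u) ⊢ρ (⊢δ⁻ ⊢t ⊢s ⊢u) =
  ⊢δ⁻ (⊢unrename t ⊢ρ ⊢t) (⊢unrename s (Renaming.⊢↑ ⊢ρ) ⊢s) (⊢unrename u (Renaming.⊢↑ ⊢ρ) ⊢u)
⊢unrename (ν _ t) ⊢ρ (⊢ν⁺ ⊢t) = ⊢ν⁺ (⊢unrename t ⊢ρ ⊢t)
⊢unrename (ν _ t) ⊢ρ (⊢ν⁻ ⊢t) = ⊢ν⁻ (⊢unrename t ⊢ρ ⊢t)
⊢unrename (μ _ t) ⊢ρ (⊢μ⁺ ⊢t) = ⊢μ⁺ (⊢unrename t ⊢ρ ⊢t)
⊢unrename (μ _ t) ⊢ρ (⊢μ⁻ ⊢t) = ⊢μ⁻ (⊢unrename t ⊢ρ ⊢t)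
⊢unrename (IC _ _ t) ⊢ρ (⊢IC⁺ ⊢t) = ⊢IC⁺ (⊢unrename t (Renaming.⊢↑ ⊢ρ) ⊢t)
⊢unrename (IC _ _ t) ⊢ρ (⊢IC⁻ ⊢t) = ⊢IC⁻ (⊢unrename t (Renaming.⊢↑ ⊢ρ) ⊢t)
⊢unrename (t •[ _ ] s) ⊢ρ (⊢•⁺ ⊢t ⊢s) = ⊢•⁺ (⊢unrename t ⊢ρ ⊢t) (⊢unrename s ⊢ρ ⊢s)
⊢unrename (t •[ _ ] s) ⊢ρ (⊢•⁻ ⊢t ⊢s) = ⊢•⁻ (⊢unrename t ⊢ρ ⊢t) (⊢unrename s ⊢ρ ⊢s)

⊢strengthen : ∀ {n} {Γ : Ctx n} {P Q} t → Q ∷ Γ ⊢ weaken t ∶ P → Γ ⊢ t ∶ P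
⊢strengthen t = ⊢unrename t ⊢wkᵛ

⊢⋈ : ∀ {n} {Γ : Ctx n} P {Q t s} →
     Γ ⊢ t ∶ P → Γ ⊢ s ∶ P ~ → Γ ⊢ t ⦂ P ⋈[ Q ] s ∶ Q
⊢⋈ (A ⁺) ⊢t ⊢s = ⊢abs strong⁺ ⊢t ⊢s
⊢⋈ (A ⁻) ⊢t ⊢s = ⊢abs strong⁻ ⊢t ⊢s
⊢⋈ (A ⊕) ⊢t ⊢s = ⊢abs strong⁺ (⊢•⁺ ⊢t ⊢s) (⊢•⁻ ⊢s ⊢t)
⊢⋈ (A ⊖) ⊢t ⊢s = ⊢abs strong⁻ (⊢•⁻ ⊢t ⊢s) (⊢•⁺ ⊢s ⊢t)

preservation : ∀ {n} {Γ : Ctx n} {t t′ P} → Γ ⊢ t ∶ P → Γ ⊢ t ⇝ t′ → Γ ⊢ t′ ∶ P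
-- The index is split so that `pick` computes both in the contractum and in its type.
preservation (⊢π⁺ _ (⊢pair⁺ ⊢t ⊢s)) (β-π 0F) = ⊢t
preservation (⊢π⁺ _ (⊢pair⁺ ⊢t ⊢s)) (β-π 1F) = ⊢s
preservation (⊢π⁻ _ (⊢pair⁻ ⊢t ⊢s)) (β-π 0F) = ⊢t
preservation (⊢π⁻ _ (⊢pair⁻ ⊢t ⊢s)) (β-π 1F) = ⊢s
preservation (⊢δ⁺ (⊢inj⁺ _ ⊢t) ⊢s ⊢u) (β-δ 0F) = ⊢/ (⊢sub ⊢t) ⊢s
preservation (⊢δ⁺ (⊢inj⁺ _ ⊢t) ⊢s ⊢u) (β-δ 1F) = ⊢/ (⊢sub ⊢t) ⊢u
preservation (⊢δ⁻ (⊢inj⁻ _ ⊢t) ⊢s ⊢u) (β-δ 0F) = ⊢/ (⊢sub ⊢t) ⊢s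
preservation (⊢δ⁻ (⊢inj⁻ _ ⊢t) ⊢s ⊢u) (β-δ 1F) = ⊢/ (⊢sub ⊢t) ⊢u
preservation (⊢μ⁺ (⊢ν⁺ ⊢t)) β-μ = ⊢t
preservation (⊢μ⁻ (⊢ν⁻ ⊢t)) β-μ = ⊢t
preservation (⊢•⁺ (⊢IC⁺ ⊢t) ⊢s) β-IC = ⊢/ (⊢sub ⊢s) ⊢t
preservation (⊢•⁻ (⊢IC⁻ ⊢t) ⊢s) β-IC = ⊢/ (⊢sub ⊢s) ⊢t
-- The absurdity rules carry typings of both components at the very type `P` that selects the form
-- of `⋈`.
preservation (⊢abs _ _ _) (pair-inj {P = P} _ ⊢t ⊢s) = ⊢⋈ P ⊢t ⊢s
preservation (⊢abs _ _ _) (inj-pair {P = P} _ ⊢t ⊢s) = ⊢⋈ P ⊢t ⊢s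
preservation (⊢abs _ _ _) (ν-ν {P = P} ⊢t ⊢s) = ⊢⋈ P ⊢t ⊢s
preservation (⊢IC⁺ (⊢•⁺ ⊢t _)) (η-IC {t = t}) = ⊢strengthen t ⊢t
preservation (⊢IC⁻ (⊢•⁻ ⊢t _)) (η-IC {t = t}) = ⊢strengthen t ⊢t
preservation (⊢abs p ⊢t ⊢s) (ξ-abs₁ r) = ⊢abs p (preservation ⊢t r) ⊢s
preservation (⊢abs p ⊢t ⊢s) (ξ-abs₂ r) = ⊢abs p ⊢t (preservation ⊢s r)
preservation (⊢pair⁺ ⊢t ⊢s) (ξ-pair₁ r) = ⊢pair⁺ (preservation ⊢t r) ⊢s
preservation (⊢pair⁻ ⊢t ⊢s) (ξ-pair₁ r) = ⊢pair⁻ (preservation ⊢t r) ⊢s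
preservation (⊢pair⁺ ⊢t ⊢s) (ξ-pair₂ r) = ⊢pair⁺ ⊢t (preservation ⊢s r)
preservation (⊢pair⁻ ⊢t ⊢s) (ξ-pair₂ r) = ⊢pair⁻ ⊢t (preservation ⊢s r)
preservation (⊢π⁺ i ⊢t) (ξ-π r) = ⊢π⁺ i (preservation ⊢t r)
preservation (⊢π⁻ i ⊢t) (ξ-π r) = ⊢π⁻ i (preservation ⊢t r)
preservation (⊢inj⁺ i ⊢t) (ξ-inj r) = ⊢inj⁺ i (preservation ⊢t r)
preservation (⊢inj⁻ i ⊢t) (ξ-inj r) = ⊢inj⁻ i (preservation ⊢t r)
preservation (⊢δ⁺ ⊢t ⊢s ⊢u) (ξ-δ r) = ⊢δ⁺ (preservation ⊢t r) ⊢s ⊢u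
preservation (⊢δ⁻ ⊢t ⊢s ⊢u) (ξ-δ r) = ⊢δ⁻ (preservation ⊢t r) ⊢s ⊢u
preservation (⊢δ⁺ ⊢t ⊢s ⊢u) (ξ-δ₁ r) = ⊢δ⁺ ⊢t (preservation ⊢s r) ⊢u
preservation (⊢δ⁻ ⊢t ⊢s ⊢u) (ξ-δ₁ r) = ⊢δ⁻ ⊢t (preservation ⊢s r) ⊢u
preservation (⊢δ⁺ ⊢t ⊢s ⊢u) (ξ-δ₂ r) = ⊢δ⁺ ⊢t ⊢s (preservation ⊢u r)
preservation (⊢δ⁻ ⊢t ⊢s ⊢u) (ξ-δ₂ r) = ⊢δ⁻ ⊢t ⊢s (preservation ⊢u r)
preservation (⊢ν⁺ ⊢t) (ξ-ν r) = ⊢ν⁺ (preservation ⊢t r)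
preservation (⊢ν⁻ ⊢t) (ξ-ν r) = ⊢ν⁻ (preservation ⊢t r)
preservation (⊢μ⁺ ⊢t) (ξ-μ r) = ⊢μ⁺ (preservation ⊢t r)
preservation (⊢μ⁻ ⊢t) (ξ-μ r) = ⊢μ⁻ (preservation ⊢t r)
preservation (⊢IC⁺ ⊢t) (ξ-IC r) = ⊢IC⁺ (preservation ⊢t r)
preservation (⊢IC⁻ ⊢t) (ξ-IC r) = ⊢IC⁻ (preservation ⊢t r)
preservation (⊢•⁺ ⊢t ⊢s) (ξ-•₁ r) = ⊢•⁺ (preservation ⊢t r) ⊢s
preservation (⊢•⁻ ⊢t ⊢s) (ξ-•₁ r) = ⊢•⁻ (preservation ⊢t r) ⊢s
preservation (⊢•⁺ ⊢t ⊢s) (ξ-•₂ r) = ⊢•⁺ ⊢t (preservation ⊢s r)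
preservation (⊢•⁻ ⊢t ⊢s) (ξ-•₂ r) = ⊢•⁻ ⊢t (preservation ⊢s r)

-- Compatibility of reduction with substitution.

⋈-/ : ∀ {m n} P {Q} {t s : Tm m} {ρ : Sub Tm m n} →
      (t / ρ) ⦂ P ⋈[ Q ] (s / ρ) ≡ (t ⦂ P ⋈[ Q ] s) / ρ
⋈-/ (A ⁺) = refl
⋈-/ (A ⁻) = refl
⋈-/ (A ⊕) = refl
⋈-/ (A ⊖) = refl

⇝-respʳ-≡ : ∀ {n} {Γ : Ctx n} {t u u′} → u ≡ u′ → Γ ⊢ t ⇝ u → Γ ⊢ t ⇝ u′
⇝-respʳ-≡ refl r = r

-- The substitution has to be typed since the absurdity rules contain typing premises, which must be
-- transported to `Δ`. The instance applied below is `wk`, which carries reductions under binders.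
⇝-/ : ∀ {m n Γ Δ t t′} {ρ : Sub Tm m n} →
      ρ ∶ Γ ⇒ˢ Δ → Γ ⊢ t ⇝ t′ → Δ ⊢ t / ρ ⇝ t′ / ρ
⇝-/ ⊢ρ (β-π 0F) = β-π 0F
⇝-/ ⊢ρ (β-π 1F) = β-π 1F
⇝-/ ⊢ρ (β-δ {s₁ = s₁} 0F) = ⇝-respʳ-≡ (sym (sub-commutes s₁)) (β-δ 0F)
⇝-/ ⊢ρ (β-δ {s₂ = s₂} 1F) = ⇝-respʳ-≡ (sym (sub-commutes s₂)) (β-δ 1F)
⇝-/ ⊢ρ β-μ = β-μ
⇝-/ ⊢ρ (β-IC {t = t}) = ⇝-respʳ-≡ (sym (sub-commutes t)) β-IC
⇝-/ ⊢ρ (pair-inj {P = P} 0F ⊢t ⊢s) =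
  ⇝-respʳ-≡ (⋈-/ P) (pair-inj 0F (⊢/ ⊢ρ ⊢t) (⊢/ ⊢ρ ⊢s))
⇝-/ ⊢ρ (pair-inj {P = P} 1F ⊢t ⊢s) =
  ⇝-respʳ-≡ (⋈-/ P) (pair-inj 1F (⊢/ ⊢ρ ⊢t) (⊢/ ⊢ρ ⊢s))
⇝-/ ⊢ρ (inj-pair {P = P} 0F ⊢t ⊢s) =
  ⇝-respʳ-≡ (⋈-/ P) (inj-pair 0F (⊢/ ⊢ρ ⊢t) (⊢/ ⊢ρ ⊢s))
⇝-/ ⊢ρ (inj-pair {P = P} 1F ⊢t ⊢s) =
  ⇝-respʳ-≡ (⋈-/ P) (inj-pair 1F (⊢/ ⊢ρ ⊢t) (⊢/ ⊢ρ ⊢s))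
⇝-/ ⊢ρ (ν-ν {P = P} ⊢t ⊢s) =
  ⇝-respʳ-≡ (⋈-/ P) (ν-ν (⊢/ ⊢ρ ⊢t) (⊢/ ⊢ρ ⊢s))
-- By `weaken-↑` the function part is again a weakened term, so the substituted term is still an
-- η-redex.
⇝-/ {ρ = ρ} ⊢ρ (η-IC {σ} {P} {t}) =
  subst (λ u → _ ⊢ IC σ P (u •[ σ ] var 0F) ⇝ t / ρ) (sym (weaken-↑ t)) η-IC
⇝-/ ⊢ρ (ξ-abs₁ r)  = ξ-abs₁ (⇝-/ ⊢ρ r)
⇝-/ ⊢ρ (ξ-abs₂ r)  = ξ-abs₂ (⇝-/ ⊢ρ r)
⇝-/ ⊢ρ (ξ-pair₁ r) = ξ-pair₁ (⇝-/ ⊢ρ r)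
⇝-/ ⊢ρ (ξ-pair₂ r) = ξ-pair₂ (⇝-/ ⊢ρ r)
⇝-/ ⊢ρ (ξ-π r)     = ξ-π (⇝-/ ⊢ρ r)
⇝-/ ⊢ρ (ξ-inj r)   = ξ-inj (⇝-/ ⊢ρ r)
⇝-/ ⊢ρ (ξ-δ r)     = ξ-δ (⇝-/ ⊢ρ r)
⇝-/ ⊢ρ (ξ-δ₁ r)    = ξ-δ₁ (⇝-/ (⊢↑ ⊢ρ) r)
⇝-/ ⊢ρ (ξ-δ₂ r)    = ξ-δ₂ (⇝-/ (⊢↑ ⊢ρ) r)
⇝-/ ⊢ρ (ξ-ν r)     = ξ-ν (⇝-/ ⊢ρ r)
⇝-/ ⊢ρ (ξ-μ r)     = ξ-μ (⇝-/ ⊢ρ r)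
⇝-/ ⊢ρ (ξ-IC r)    = ξ-IC (⇝-/ (⊢↑ ⊢ρ) r)
⇝-/ ⊢ρ (ξ-•₁ r)    = ξ-•₁ (⇝-/ ⊢ρ r)
⇝-/ ⊢ρ (ξ-•₂ r)    = ξ-•₂ (⇝-/ ⊢ρ r)

infix 4 _⊢_⇝*_

_⊢_⇝*_ : ∀ {n} → Ctx n → Tm n → Tm n → Set
Γ ⊢ t ⇝* s = Star (Γ ⊢_⇝_) t s

⇝*⇒⟶* : ∀ {n} {Γ : Ctx n} {t t′ P} → Γ ⊢ t ∶ P → Γ ⊢ t ⇝* t′ → Γ ⊢ t ⟶* t′
⇝*⇒⟶* ⊢t ε        = ε
⇝*⇒⟶* ⊢t (r ◅ rs) = ((_ , ⊢t) , r) ◅ ⇝*⇒⟶* (preservation ⊢t r) rs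

⇝*-weaken : ∀ {n} {Γ : Ctx n} {t t′ Q} → Γ ⊢ t ⇝* t′ → Q ∷ Γ ⊢ weaken t ⇝* weaken t′
⇝*-weaken = gmap weaken λ {t} {t′} r →
  -- `weaken` is a renaming, while `⇝-/` speaks of term substitutions; `/-wk` identifies the two.
  subst id (cong₂ (_ ⊢_⇝_) (/-wk {t = t}) (/-wk {t = t′})) (⇝-/ ⊢wk r)

infix 4 _⊢_⇝ˢ_

_⊢_⇝ˢ_ : ∀ {m n} → Ctx n → Sub Tm m n → Sub Tm m n → Set
Γ ⊢ ρ ⇝ˢ ρ′ = ∀ x → Γ ⊢ lookup ρ x ⇝* lookup ρ′ x

⇝ˢ-↑ : ∀ {m n} {Γ : Ctx n} {ρ ρ′ : Sub Tm m n} {Q} →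
       Γ ⊢ ρ ⇝ˢ ρ′ → Q ∷ Γ ⊢ ρ ↑ ⇝ˢ ρ′ ↑
⇝ˢ-↑ rs zero = ε
⇝ˢ-↑ {ρ = ρ} {ρ′} rs (suc x) =
  subst id
    (cong₂ (_ ⊢_⇝*_) (sym (lookup-map x weaken ρ)) (sym (lookup-map x weaken ρ′)))
    (⇝*-weaken (rs x))

-- Substituted terms are reduced copy by copy, one immediate subterm of `t` after another. A
-- variable may occur any number of times, hence many steps or none. Parallel substitutions make the
-- induction go through under binders.
/-⇝ˢ : ∀ {m n} {Γ : Ctx n} (t : Tm m) {ρ ρ′ : Sub Tm m n} →
       Γ ⊢ ρ ⇝ˢ ρ′ → Γ ⊢ t / ρ ⇝* t / ρ′
/-⇝ˢ (var x) rs = rs x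
/-⇝ˢ (t ▶◀[ Q ] s) rs =
  gmap (_▶◀[ Q ] _) ξ-abs₁ (/-⇝ˢ t rs) ◅◅ gmap (_ ▶◀[ Q ]_) ξ-abs₂ (/-⇝ˢ s rs)
/-⇝ˢ (pair σ t s) rs =
  gmap (λ t → pair σ t _) ξ-pair₁ (/-⇝ˢ t rs) ◅◅ gmap (pair σ _) ξ-pair₂ (/-⇝ˢ s rs)
/-⇝ˢ (π σ i t) rs = gmap (π σ i) ξ-π (/-⇝ˢ t rs)
/-⇝ˢ (inj σ i t) rs = gmap (inj σ i) ξ-inj (/-⇝ˢ t rs)
/-⇝ˢ (δ σ t P s Q u) rs =
  gmap (λ t → δ σ t P _ Q _) ξ-δ (/-⇝ˢ t rs)
    ◅◅ gmap (λ s → δ σ _ P s Q _) ξ-δ₁ (/-⇝ˢ s (⇝ˢ-↑ rs))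
    ◅◅ gmap (λ u → δ σ _ P _ Q u) ξ-δ₂ (/-⇝ˢ u (⇝ˢ-↑ rs))
/-⇝ˢ (ν σ t) rs = gmap (ν σ) ξ-ν (/-⇝ˢ t rs)
/-⇝ˢ (μ σ t) rs = gmap (μ σ) ξ-μ (/-⇝ˢ t rs)
/-⇝ˢ (IC σ P t) rs = gmap (IC σ P) ξ-IC (/-⇝ˢ t (⇝ˢ-↑ rs))
/-⇝ˢ (t •[ σ ] s) rs =
  gmap (_•[ σ ] _) ξ-•₁ (/-⇝ˢ t rs) ◅◅ gmap (_ •[ σ ]_) ξ-•₂ (/-⇝ˢ s rs)

sub-⇝* : ∀ {n} {Γ : Ctx n} (t : Tm (suc n)) {u u′} →
         Γ ⊢ u ⇝* u′ → Γ ⊢ t / sub u ⇝* t / sub u′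
sub-⇝* t rs = /-⇝ˢ t λ { zero → rs ; (suc x) → ε }

-- Typing of the derived terms.

⊢πᶜ : ∀ {n} {Γ : Ctx n} {A₁ A₂ t} i →
      Γ ⊢ t ∶ (A₁ ∧ A₂) ⊕ → Γ ⊢ πᶜ i A₁ A₂ t ∶ pick i A₁ A₂ ⊕
⊢πᶜ i ⊢t =
  ⊢IC⁺ (⊢•⁺ (⊢π⁺ i (⊢•⁺ (⊢weaken ⊢t) (⊢IC⁻ (⊢inj⁻ i (⊢var 1F))))) (⊢var 0F))

⊢pairᶜ : ∀ {n} {Γ : Ctx n} {A B t s} →
         Γ ⊢ t ∶ A ⊕ → Γ ⊢ s ∶ B ⊕ → Γ ⊢ pairᶜ A B t s ∶ (A ∧ B) ⊕
⊢pairᶜ ⊢t ⊢s = ⊢IC⁺ (⊢pair⁺ (⊢weaken ⊢t) (⊢weaken ⊢s))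

⊢injᶜ : ∀ {n} {Γ : Ctx n} {A₁ A₂ t} i →
        Γ ⊢ t ∶ pick i A₁ A₂ ⊕ → Γ ⊢ injᶜ i A₁ A₂ t ∶ (A₁ ∨ A₂) ⊕
⊢injᶜ i ⊢t = ⊢IC⁺ (⊢inj⁺ i (⊢weaken ⊢t))

⊢↕ : ∀ {n} {Γ : Ctx n} {A Q t} →
     (A ⊕) ∷ Γ ⊢ t ∶ Q → (Q ~) ∷ Γ ⊢ ↕ A Q t ∶ A ⊖
⊢↕ {Q = Q} ⊢t = ⊢IC⁻ (⊢⋈ Q (⊢weaken₁ ⊢t) (⊢var 1F))

⊢δᶜ : ∀ {n} {Γ : Ctx n} {A B C t s u} →
      Γ ⊢ t ∶ (A ∨ B) ⊕ → (A ⊕) ∷ Γ ⊢ s ∶ C ⊕ → (B ⊕) ∷ Γ ⊢ u ∶ C ⊕ →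
      Γ ⊢ δᶜ A B C t s u ∶ C ⊕
⊢δᶜ ⊢t ⊢s ⊢u =
  ⊢IC⁺ (⊢δ⁺ (⊢•⁺ (⊢weaken ⊢t) (⊢IC⁻ (⊢pair⁻ (⊢weaken (⊢↕ ⊢s)) (⊢weaken (⊢↕ ⊢u)))))
            (⊢•⁺ (⊢weaken₁ ⊢s) (⊢var 1F))
            (⊢•⁺ (⊢weaken₁ ⊢u) (⊢var 1F)))

⊢var-≡ : ∀ {n} {Γ : Ctx n} {P} x → lookup Γ x ≡ P → Γ ⊢ var x ∶ P
⊢var-≡ x refl = ⊢var x

⊢Δ : ∀ {n} {Γ : Ctx n} {A} y → lookup Γ y ≡ (¬ A) ⊖ → Γ ⊢ Δ A y ∶ (A ∨ ¬ A) ⊕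
⊢Δ {A = A} y eq =
  ⊢IC⁺ (⊢inj⁺ 0F (⊢IC⁺ (⊢⋈ ((¬ A) ⊖)
    (⊢var-≡ (suc (suc y)) eq)
    (⊢IC⁺ (⊢ν⁺ (⊢var 1F))))))

⊢⋔ᶜ : ∀ {n} {Γ : Ctx n} A → Γ ⊢ ⋔ᶜ A ∶ (A ∨ ¬ A) ⊕
⊢⋔ᶜ A =
  ⊢IC⁺ (⊢inj⁺ 1F (⊢IC⁺ (⊢ν⁺ (⊢π⁻ 0F (⊢•⁻ (⊢var 1F) (⊢Δ 0F refl))))))

⊢X : ∀ {n} {Γ : Ctx n} {A B} y → lookup Γ y ≡ (A ⇒ B) ⊖ → Γ ⊢ X A B y ∶ A ⊕
⊢X y eq =
  ⊢IC⁺ (⊢•⁺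
    (⊢μ⁻ (⊢•⁻
      (⊢π⁻ 0F (⊢•⁻ (⊢var-≡ (suc y) eq)
                   (⊢IC⁺ (⊢inj⁺ 0F (⊢IC⁺ (⊢ν⁺ (⊢var 2F)))))))
      (⊢IC⁺ (⊢ν⁺ (⊢var 1F)))))
    (⊢var 0F))

⊢ƛᶜ : ∀ {n} {Γ : Ctx n} {A B t} →
      (A ⊕) ∷ Γ ⊢ t ∶ B ⊕ → Γ ⊢ ƛᶜ A B t ∶ (A ⇒ B) ⊕
⊢ƛᶜ ⊢t = ⊢IC⁺ (⊢inj⁺ 1F (⊢/ (⊢sub (⊢X 0F refl)) (⊢weaken₁ ⊢t)))

⊢appᶜ : ∀ {n} {Γ : Ctx n} {A B t s} →
        Γ ⊢ t ∶ (A ⇒ B) ⊕ → Γ ⊢ s ∶ A ⊕ → Γ ⊢ appᶜ A B t s ∶ B ⊕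
⊢appᶜ {Γ = Γ} {A} {s = s} ⊢t ⊢s =
  ⊢IC⁺ (⊢δ⁺
    (⊢•⁺ (⊢weaken ⊢t) (⊢IC⁻ (⊢pair⁻ (⊢IC⁻ (⊢ν⁻ ⊢www)) (⊢var 1F))))
    (⊢⋈ (A ⊕) (⊢weaken (⊢weaken ⊢s))
              (⊢μ⁺ (⊢•⁺ (⊢var 0F) (⊢IC⁻ (⊢ν⁻ ⊢www)))))
    (⊢•⁺ (⊢var 0F) (⊢var 1F)))
  where
  ⊢www : ∀ {P Q R} → P ∷ Q ∷ R ∷ Γ ⊢ weaken (weaken (weaken s)) ∶ A ⊕
  ⊢www = ⊢weaken (⊢weaken (⊢weaken ⊢s))

-- Computation rules of the derived terms.

πᶜ-pairᶜ : ∀ {n} {Γ : Ctx n} {A₁ A₂ t₁ t₂} i →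
           Γ ⊢ πᶜ i A₁ A₂ (pairᶜ A₁ A₂ t₁ t₂) ⇝* pick i t₁ t₂
πᶜ-pairᶜ {Γ = Γ} {t₁ = t₁} {t₂} i =
  ξ-IC (ξ-•₁ (ξ-π (⇝-respʳ-≡ (cong₂ (pair +) (weaken₁-weaken-/-sub t₁ _)
                                               (weaken₁-weaken-/-sub t₂ _)) β-IC)))
    ◅ ξ-IC (ξ-•₁ (β-π i))
    ◅ η i
  where
  -- Projection yields a `pick` of weakened terms, whereas η asks for a weakened term; the two agree
  -- once `i` is concrete.
  η : ∀ {P} i → Γ ⊢ IC + P (pick i (weaken t₁) (weaken t₂) •[ + ] var 0F)
                    ⇝* pick i t₁ t₂
  η 0F = η-IC ◅ ε
  η 1F = η-IC ◅ ε

δᶜ-injᶜ : ∀ {n} {Γ : Ctx n} {A₁ A₂ C t s₁ s₂} i →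
          Γ ⊢ δᶜ A₁ A₂ C (injᶜ i A₁ A₂ t) s₁ s₂ ⇝* pick i s₁ s₂ / sub t
δᶜ-injᶜ {Γ = Γ} {C = C} {t} {s₁} {s₂} i =
  ξ-IC (ξ-δ (⇝-respʳ-≡ (cong (inj + i) (weaken₁-weaken-/-sub t _)) β-IC))
    ◅ ξ-IC (β-δ i)
    ◅ finish i
  where
  -- Neither `s` nor `t` mentions the variable of the outer `IC`, so the function part is
  -- `weaken (s / sub t)`, which exposes the η-redex.
  η : ∀ s → Γ ⊢ IC + (C ⊖) ((weaken₁ s / sub (weaken t)) •[ + ] var 0F) ⇝* s / sub t
  η s = subst (λ u → Γ ⊢ IC + (C ⊖) (u •[ + ] var 0F) ⇝* s / sub t)
              (sub-commutes-with-renaming {t = s}) (η-IC ◅ ε)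

  finish : ∀ i → Γ ⊢ IC + (C ⊖) (pick i (weaken₁ s₁ •[ + ] var 1F)
                                        (weaken₁ s₂ •[ + ] var 1F) / sub (weaken t))
                   ⇝* pick i s₁ s₂ / sub t
  finish 0F = η s₁
  finish 1F = η s₂

module _ {n : ℕ} {Γ : Ctx n} (A B : Prp) (s : Tm n) where

  -- What  t @ᶜ s  feeds to t;  var 1F  is the outer variable x : B ⊖.
  arg : Tm (suc n)
  arg = IC - ((A ⇒ B) ⊕)
          (pair - (IC - ((¬ A) ⊕) (ν - (weaken (weaken (weaken s))))) (var 1F))

  -- With `arg` for y, the dummy abstraction in `arg` discards what X′ feeds to it and leaves a
  -- pair. Its first component is a dummy abstraction over `ν -` of s; applying it leaves that
  -- `ν -`, which `μ -` cancels. What remains is the η-expansion of s.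
  X-arg : (B ⊖) ∷ Γ ⊢ weaken₁ (X A B 0F) / sub arg ⇝* weaken s
  X-arg =
    ξ-IC (ξ-•₁ (ξ-μ (ξ-•₁ (ξ-π (⇝-respʳ-≡
        (cong (λ u → pair - (IC - ((¬ A) ⊕) (ν - u)) (var 1F))
              (www-/ (IC + ((A ⇒ B) ⊖) (inj + 0F (IC + ((¬ A) ⊖) (ν + (var 2F)))))))
        β-IC)))))
      ◅ ξ-IC (ξ-•₁ (ξ-μ (ξ-•₁ (β-π 0F))))
      ◅ ξ-IC (ξ-•₁ (ξ-μ (⇝-respʳ-≡
          (cong (ν -) (weaken-sub (weaken (weaken s)))) β-IC)))
      ◅ ξ-IC (ξ-•₁ β-μ)
      ◅ η-IC
      ◅ ε
    where
    -- Inside `arg`, s lies below two binders. Moving `arg` under z therefore renames with two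
    -- lifts, and contracting the outer dummy abstraction substitutes with one. Neither touches a
    -- variable of s itself.
    www-/ : ∀ u → weaken (weaken (weaken s)) /Var (VarSubst.wk VarSubst.↑ VarSubst.↑)
                    / (sub u ↑)
                  ≡ weaken (weaken (weaken s))
    www-/ u = begin
      weaken (weaken (weaken s)) /Var (VarSubst.wk VarSubst.↑ VarSubst.↑) / (sub u ↑)
        ≡⟨ cong (_/ (sub u ↑)) (weaken-/Var-↑ (weaken (weaken s)) _) ⟩
      weaken (weaken₁ (weaken (weaken s))) / (sub u ↑)
        ≡⟨ weaken-↑ (weaken₁ (weaken (weaken s))) ⟩
      weaken (weaken₁ (weaken (weaken s)) / sub u)
        ≡⟨ cong weaken (weaken₁-weaken-/-sub (weaken s) u) ⟩
      weaken (weaken (weaken s))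
        ∎
      where open ≡-Reasoning

appᶜ-ƛᶜ : ∀ {n} {Γ : Ctx n} {A B s} t →
          Γ ⊢ appᶜ A B (ƛᶜ A B t) s ⇝* t / sub s
appᶜ-ƛᶜ {Γ = Γ} {A} {B} {s} t =
  -- The contractum is rewritten so that x receives a single term, X_y with `arg` for y; `sub-⇝*`
  -- can then reduce all its copies by `X-arg`.
  ξ-IC (ξ-δ (⇝-respʳ-≡ (cong (inj + 1F) (weaken₁-/-sub-/-sub t (X A B 0F) _)) β-IC))
    ◅ ξ-IC (β-δ 1F)
    ◅ gmap (λ u → IC + (B ⊖) (u •[ + ] var 0F)) (ξ-IC ∘ ξ-•₁)
           (sub-⇝* (weaken₁ t) (X-arg A B s))
    ◅◅ subst (λ u → Γ ⊢ IC + (B ⊖) (u •[ + ] var 0F) ⇝* t / sub s)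
             (sub-commutes-with-renaming {t = t}) (η-IC ◅ ε)

-- The second disjunct of `⋔ᶜ` reaches `s₂` with its free variable replaced by a dummy abstraction
-- over the pair of contrapositives of `s₁` and `s₂`. Applied to `Δ A 0F` it discards it, and the
-- first projection selects `↕ A (C ⊕) s₁`, which under `ν +` is the body of `star A C s₁`.
δᶜ-⋔ᶜ : ∀ {n} {Γ : Ctx n} {A C} s₁ s₂ →
        Γ ⊢ δᶜ A (¬ A) C (⋔ᶜ A) s₁ s₂
          ⇝* IC + (C ⊖) ((weaken₁ s₂ / sub (star A C s₁)) •[ + ] var 0F)
δᶜ-⋔ᶜ {A = A} {C} s₁ s₂ =
  -- `⋔ᶜ A` is closed, so its weakening computes away and the contractum has the right form already.
  ξ-IC (ξ-δ β-IC)
    ◅ ξ-IC (β-δ 1F)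
    ◅ gmap (λ u → IC + (C ⊖) (u •[ + ] var 0F)) (ξ-IC ∘ ξ-•₁)
           (sub-⇝* (weaken₁ s₂)
             ( ξ-IC (ξ-ν (ξ-π (⇝-respʳ-≡
                 (cong₂ (pair -) (weaken₁-weaken-/-sub (↕ A (C ⊕) s₁) (Δ A 0F))
                                 (weaken₁-weaken-/-sub (↕ (¬ A) (C ⊕) s₂) (Δ A 0F)))
                 β-IC)))
             ◅ ξ-IC (ξ-ν (β-π 0F))
             ◅ ε))

lemma40 :
  (∀ {n : ℕ} {Γ : Ctx n} {A₁ A₂ : Prp} {t₁ t₂ : Tm n} (i : Fin 2) →
     Γ ⊢ t₁ ∶ A₁ ⊕ →
     Γ ⊢ t₂ ∶ A₂ ⊕ →
     Γ ⊢ πᶜ i A₁ A₂ (pairᶜ A₁ A₂ t₁ t₂) ⟶* pick i t₁ t₂)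
  × (∀ {n : ℕ} {Γ : Ctx n} {A₁ A₂ C : Prp} {t : Tm n} {s₁ s₂ : Tm (suc n)} (i : Fin 2) →
     Γ ⊢ t ∶ pick i A₁ A₂ ⊕ →
     (A₁ ⊕) ∷ Γ ⊢ s₁ ∶ C ⊕ →
     (A₂ ⊕) ∷ Γ ⊢ s₂ ∶ C ⊕ →
     Γ ⊢ δᶜ A₁ A₂ C (injᶜ i A₁ A₂ t) s₁ s₂ ⟶* (pick i s₁ s₂ / sub t))
  × (∀ {n : ℕ} {Γ : Ctx n} {A B : Prp} {t : Tm (suc n)} {s : Tm n} →
     (A ⊕) ∷ Γ ⊢ t ∶ B ⊕ →
     Γ ⊢ s ∶ A ⊕ →
     Γ ⊢ appᶜ A B (ƛᶜ A B t) s ⟶* (t / sub s))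
  × (∀ {n : ℕ} {Γ : Ctx n} {A C : Prp} {s₁ s₂ : Tm (suc n)} →
     (A ⊕) ∷ Γ ⊢ s₁ ∶ C ⊕ →
     ((¬ A) ⊕) ∷ Γ ⊢ s₂ ∶ C ⊕ →
     Γ ⊢ δᶜ A (¬ A) C (⋔ᶜ A) s₁ s₂
       ⟶* IC + (C ⊖) ((weaken₁ s₂ / sub (star A C s₁)) •[ + ] var zero))
lemma40 =
    (λ i ⊢t₁ ⊢t₂ → ⇝*⇒⟶* (⊢πᶜ i (⊢pairᶜ ⊢t₁ ⊢t₂)) (πᶜ-pairᶜ i))
  , (λ i ⊢t ⊢s₁ ⊢s₂ → ⇝*⇒⟶* (⊢δᶜ (⊢injᶜ i ⊢t) ⊢s₁ ⊢s₂) (δᶜ-injᶜ i))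
  , (λ {_} {_} {_} {_} {t} ⊢t ⊢s → ⇝*⇒⟶* (⊢appᶜ (⊢ƛᶜ ⊢t) ⊢s) (appᶜ-ƛᶜ t))
  , (λ {_} {_} {A} {_} {s₁} {s₂} ⊢s₁ ⊢s₂ →
       ⇝*⇒⟶* (⊢δᶜ (⊢⋔ᶜ A) ⊢s₁ ⊢s₂) (δᶜ-⋔ᶜ s₁ s₂))
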